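{- Let $p\ge 0$ be an integer and let $G$ be a minimal forbidden interval subgraph for the class of $p$-improper interval graphs, with basepoint $z$. Let $H$ be an unconfined, exterior side component of $G$. Then $H$ consists of precisely two vertices: an exterior vertex (a vertex at distance at least $2$ from $z$), and a vertex connecting it to the basepoint (a vertex adjacent both to the exterior vertex and to $z$).
   Context: All graphs are finite and simple. An interval graph is a graph $G=(V,E)$ having a representation $\alpha: v\mapsto I_v$ by intervals of the real line such that, for distinct $v,w$, $vw\in E$ if and only if $I_v\cap I_w\neq\emptyset$. $G$ is $p$-improper if it has a representation in which no interval properly contains more than $p$ other intervals. The impropriety $\mathrm{imp}(G)$ is the smallest $p$ such that $G$ is $p$-improper. A minimal forbidden interval subgraph for the class of $p$-improper interval graphs is an interval graph that is not $p$-improper but all of whose proper (induced) subgraphs are $p$-improper. A basepoint of $G$ is a vertex $z$ such that in every representation $I_z$ properly contains the intervals of at least $\mathrm{imp}(G)$ other vertices; "the basepoint" denotes this vertex $z$. The local components of $G$ are the connected components of $G\setminus\{z\}$; the support of a local component is the union of the intervals of its vertices. Given a representation, order the local components $H_0,\dots,H_m$ by their supports from left to right; $H_0$ and $H_m$ are the side components. A potential side component is a local component that is a side component in some representation. A vertex contributes to the impropriety of $G$ in a representation if its interval is properly contained in $I_z$. A side component is exterior if it contains at least one vertex at distance at least $2$ from $z$ (such a vertex is called an exterior vertex), and non-exterior otherwise. A potential side component $H$ is unconfined if there is a representation of $G$ in which $H$ contains no vertex that contributes to the impropriety of $G$; it is confined if in every representation it contains at least one such vertex. -}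

module Defs where

open import Level using (0ℓ) renaming (suc to lsuc)
open import Data.Nat.Base as ℕ using (ℕ; zero; suc)
open import Data.Rational.Base as ℚ using (ℚ)
open import Data.Fin.Base using (Fin)
open import Data.Fin.Subset as Sub using (Subset)
open import Data.Product.Base using (_×_; ∃-syntax; Σ-syntax)
open import Data.Sum.Base using (_⊎_)
open import Function.Bundles using (_↣_; _⇔_; module Injection)
open import Relation.Nullary.Negation.Core using (¬_)
open import Relation.Unary using (Pred; Satisfiable; _∈_; _⊂_; _≬_)
open import Relation.Binary.Core using (Rel)
open import Relation.Binary.Definitions using (Decidable; Symmetric)
open import Relation.Binary.PropositionalEquality.Core using (_≡_; _≢_)
open import Relation.Binary.Construct.Closure.ReflexiveTransitive using (Star)

-- Dedekind reals (two-sided, rounded, located cuts).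
record ℝ : Set₁ where
  field
    lower upper     : Pred ℚ 0ℓ
    lower-inhabited : Satisfiable lower
    upper-inhabited : Satisfiable upper
    lower-rounded   : ∀ q → q ∈ lower ⇔ (∃[ r ] q ℚ.< r × r ∈ lower)
    upper-rounded   : ∀ r → r ∈ upper ⇔ (∃[ q ] q ℚ.< r × q ∈ upper)
    disjoint        : ∀ q → ¬ (q ∈ lower × q ∈ upper)
    located         : ∀ {q r} → q ℚ.< r → q ∈ lower ⊎ r ∈ upper

open ℝ public

infix 4 _<ᵣ_ _≤ᵣ_

_<ᵣ_ : Rel ℝ 0ℓ
x <ᵣ y = ∃[ q ] q ∈ upper x × q ∈ lower y

_≤ᵣ_ : Rel ℝ 0ℓ
x ≤ᵣ y = ¬ (y <ᵣ x)

-- Intervals are the nonempty order-convex sets of reals, so open, half-open,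
-- unbounded and one-point intervals are all included.
record Interval : Set₁ where
  field
    points   : Pred ℝ 0ℓ
    nonempty : Satisfiable points
    convex   : ∀ x y t → x ∈ points → y ∈ points →
               x ≤ᵣ t → t ≤ᵣ y → t ∈ points

open Interval public

infix 4 _meets_ _properlyContains_

_meets_ : Interval → Interval → Set₁
I meets J = points I ≬ points J

_properlyContains_ : Interval → Interval → Set₁
I properlyContains J = points J ⊂ points I

record Graph : Set₁ where
  infix 4 _~_ _~?_
  field
    size     : ℕ
    _~_      : Rel (Fin size) 0ℓ
    _~?_     : Decidable _~_
    ~-sym    : Symmetric _~_
    ~-irrefl : ∀ {v} → ¬ (v ~ v)

  Vertex : Set
  Vertex = Fin size

open Graph public using (size; Vertex)

-- The subgraph induced on the image of f.  Up to isomorphism, the proper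
-- induced subgraphs of G are the graphs induced G f with m < size G.
induced : (G : Graph) {m : ℕ} → Fin m ↣ Vertex G → Graph
induced G {m} f = record
  { size     = m
  ; _~_      = λ u v → to u ~ to v
  ; _~?_     = λ u v → to u ~? to v
  ; ~-sym    = ~-sym
  ; ~-irrefl = ~-irrefl
  }
  where
  open Graph G
  open Injection f using (to)

AtLeast : ∀ {a} {A : Set} → ℕ → Pred A a → Set a
AtLeast {A = A} k P = Σ[ f ∈ (Fin k ↣ A) ] (∀ i → Injection.to f i ∈ P)

record Representation (G : Graph) : Set₁ where
  open Graph G using (_~_)
  field
    interval : Vertex G → Interval
    edges    : ∀ {v w} → v ≢ w → v ~ w ⇔ interval v meets interval w

open Representation public

-- v itself is never counted, as proper containment is irreflexive.
ContainedIn : {G : Graph} → Representation G → Vertex G → Pred (Vertex G) (lsuc 0ℓ)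
ContainedIn α v w = interval α v properlyContains interval α w

IsIntervalGraph : Graph → Set₁
IsIntervalGraph G = Representation G

Improper : ℕ → Graph → Set₁
Improper p G =
  Σ[ α ∈ Representation G ] (∀ v → ¬ AtLeast (suc p) (ContainedIn α v))

IsImpropriety : Graph → ℕ → Set₁
IsImpropriety G k = Improper k G × (∀ p → Improper p G → k ℕ.≤ p)

record MinimalForbidden (p : ℕ) (G : Graph) : Set₁ where
  field
    isInterval  : IsIntervalGraph G
    notImproper : ¬ Improper p G
    minimal     : ∀ {m} (f : Fin m ↣ Vertex G) → m ℕ.< size G →
                  Improper p (induced G f)

module _ (G : Graph) where
  open Graph G using (_~_)

  IsBasepoint : Vertex G → Set₁
  IsBasepoint z = ∃[ k ] IsImpropriety G k ×
    (∀ (α : Representation G) → AtLeast k (ContainedIn α z))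

  data Walk : ℕ → Vertex G → Vertex G → Set where
    []  : ∀ {v} → Walk zero v v
    _∷_ : ∀ {n u v w} → u ~ v → Walk n v w → Walk (suc n) u w

  -- Vertices in different components are at infinite distance.
  DistanceAtLeast : ℕ → Rel (Vertex G) 0ℓ
  DistanceAtLeast k u v = ∀ {n} → Walk n u v → k ℕ.≤ n

  module _ (z : Vertex G) where

    LinkAvoiding : Rel (Vertex G) 0ℓ
    LinkAvoiding u v = u ≢ z × v ≢ z × u ~ v

    IsLocalComponent : Subset (size G) → Set
    IsLocalComponent H =
      ∃[ v ] v ≢ z × (∀ w → w Sub.∈ H ⇔ Star LinkAvoiding v w)

    support : Representation G → Subset (size G) → Pred ℝ 0ℓ
    support α H x = ∃[ v ] v Sub.∈ H × x ∈ points (interval α v)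

    LeftOf : Representation G → Rel (Subset (size G)) (lsuc 0ℓ)
    LeftOf α H K = ∀ x y → x ∈ support α H → y ∈ support α K → x <ᵣ y

    IsSideComponent : Representation G → Subset (size G) → Set₁
    IsSideComponent α H = IsLocalComponent H ×
      ( (∀ K → IsLocalComponent K → K ≢ H → LeftOf α H K)
      ⊎ (∀ K → IsLocalComponent K → K ≢ H → LeftOf α K H) )

    IsPotentialSideComponent : Subset (size G) → Set₁
    IsPotentialSideComponent H = ∃[ α ] IsSideComponent α H

    IsExteriorVertex : Pred (Vertex G) 0ℓ
    IsExteriorVertex v = DistanceAtLeast 2 z v

    IsExterior : Subset (size G) → Set
    IsExterior H = ∃[ v ] v Sub.∈ H × IsExteriorVertex v

    Contributes : Representation G → Pred (Vertex G) (lsuc 0ℓ)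
    Contributes α v = ContainedIn α z v

    IsUnconfined : Subset (size G) → Set₁
    IsUnconfined H =
      ∃[ α ] (∀ v → v Sub.∈ H → ¬ Contributes α v)

{-# OPTIONS --safe #-}
module Submission where

-- Write x for a vertex of H other than e and c, where e is exterior and c joins
-- e to z, and represent G ∖ x so that I_z contains at most p intervals.  The
-- vertices of H are then replaced by arbitrarily small intervals inside
-- I_c ∪ I_e: cut I_z off at a point s of I_c ∩ I_z, and put H between s and a
-- point of I_c ∩ I_e, with exactly the neighbours of z starting at s.  The order
-- of endpoints needed for this is read off a representation in which no vertex
-- of H contributes.  The result represents all of G, I_z still contains at most
-- p intervals, and this contradicts that z is a basepoint.  If H is not adjacent
-- to z at all, it is put beyond a truncated representation of G ∖ x instead.
--
-- Order and containment of real intervals are undecidable; excluded middle is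
-- used for finitely many instances only, on the way to a contradiction.

open import Defs
open import Data.Nat.Base using (ℕ)
open import Data.Fin.Subset using (Subset; ⁅_⁆; _∪_)
open import Data.Product.Base using (_×_; ∃-syntax)
open import Relation.Binary.PropositionalEquality.Core using (_≡_; _≢_)
open import Level using (0ℓ)
open import Data.Nat.Base as ℕ using (zero; suc; z≤n; s≤s)
import Data.Nat.Properties as ℕ
open import Data.Rational.Base as ℚ using (ℚ)
import Data.Rational.Properties as ℚ
open import Data.Fin.Base as Fin using (Fin; zero; suc)
import Data.Fin.Properties as Fin
import Data.Fin.Subset as Sub
import Data.Fin.Subset.Properties as Sub
import Data.Vec.Base as Vec
import Data.Vec.Properties as Vec
open import Data.Product.Base using (_,_; proj₁; proj₂; ∃; Σ-syntax)
open import Data.Sum.Base as Sum using (_⊎_; inj₁; inj₂; [_,_]; swap)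
open import Data.Empty using (⊥; ⊥-elim)
open import Effect.Monad using (RawMonad)
open import Function.Base using (_∘_; id; flip)
open import Function.Bundles using (_↣_; _⇔_; mk⇔; mk↣; module Equivalence; module Injection)
open import Relation.Nullary using (¬_; Dec; yes; no; does)
open import Relation.Nullary.Decidable
  using (¬¬-excluded-middle; dec-true; _×-dec_; _→-dec_; ¬?; toWitness)
open import Relation.Nullary.Negation using (¬¬-Monad)
open import Relation.Unary as U using (Pred; _∈_; _⊆_)
open import Relation.Binary.Core using (Rel)
open import Relation.Binary.Definitions using (Decidable)
open import Relation.Binary.PropositionalEquality
  using (refl; sym; trans; cong; subst; ≢-sym)
open import Relation.Binary.Construct.Closure.ReflexiveTransitive
  using (Star; ε; _◅_; _◅◅_; reverse)

open Equivalence using (to; from)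
open import Algebra.Properties.Group ℚ.+-0-group using () renaming (⁻¹-involutive to neg-involutive)

-- The order of the Dedekind reals

upper-closed : ∀ x {q r} → q ∈ upper x → q ℚ.≤ r → r ∈ upper x
upper-closed x {q} {r} q∈x q≤r with q ℚ.<? r
... | yes q<r = from (upper-rounded x r) (q , q<r , q∈x)
... | no q≮r  = subst (upper x) (ℚ.≤-antisym q≤r (ℚ.≮⇒≥ q≮r)) q∈x

lower<upper : ∀ x {q r} → q ∈ lower x → r ∈ upper x → q ℚ.< r
lower<upper x {q} {r} q∈x r∈x with q ℚ.<? r
... | yes q<r = q<r
... | no q≮r  = ⊥-elim (disjoint x q (q∈x , upper-closed x r∈x (ℚ.≮⇒≥ q≮r)))

≤ᵣ-refl : ∀ x → x ≤ᵣ x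
≤ᵣ-refl x (q , q∈u , q∈l) = disjoint x q (q∈l , q∈u)

<ᵣ⇒≤ᵣ : ∀ x y → x <ᵣ y → x ≤ᵣ y
<ᵣ⇒≤ᵣ x y (q , q∈ux , q∈ly) (r , r∈uy , r∈lx) =
  ℚ.<-asym (lower<upper x r∈lx q∈ux) (lower<upper y q∈ly r∈uy)

-- Roundedness opens a gap `q < r` below `x`, and locatedness puts `y` above `q` or below `r`; each
-- case contradicts one hypothesis.
≤ᵣ-trans : ∀ x y z → x ≤ᵣ y → y ≤ᵣ z → x ≤ᵣ z
≤ᵣ-trans x y z x≤y y≤z (q , q∈uz , q∈lx)
  with r , q<r , r∈lx ← to (lower-rounded x q) q∈lx
  with located y q<r
... | inj₁ q∈ly = y≤z (q , q∈uz , q∈ly)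
... | inj₂ r∈uy = x≤y (r , r∈uy , r∈lx)

≰ᵣ⇒≥ᵣ : ∀ x y → ¬ (x ≤ᵣ y) → y ≤ᵣ x
≰ᵣ⇒≥ᵣ x y x≰y x<y = x≰y (<ᵣ⇒≤ᵣ x y x<y)

-- Excluded middle for `A`, valid because the goal is absurd.
byCases : ∀ {a} (A : Set a) → (A → ⊥) → (¬ A → ⊥) → ⊥
byCases A f g = g f

fromℚ : ℚ → ℝ
fromℚ q = record
  { lower           = ℚ._< q
  ; upper           = q ℚ.<_
  ; lower-inhabited = q ℚ.- ℚ.1ℚ , subst (q ℚ.- ℚ.1ℚ ℚ.<_) (ℚ.+-identityʳ q)
                        (ℚ.+-monoʳ-< q (toWitness {a? = ℚ.- ℚ.1ℚ ℚ.<? ℚ.0ℚ} _))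
  ; upper-inhabited = q ℚ.+ ℚ.1ℚ , subst (ℚ._< q ℚ.+ ℚ.1ℚ) (ℚ.+-identityʳ q)
                        (ℚ.+-monoʳ-< q (toWitness {a? = ℚ.0ℚ ℚ.<? ℚ.1ℚ} _))
  ; lower-rounded   = λ r → mk⇔ ℚ.<-dense (λ (_ , r<m , m<q) → ℚ.<-trans r<m m<q)
  ; upper-rounded   = λ r → mk⇔ (λ q<r → let m , q<m , m<r = ℚ.<-dense q<r in m , m<r , q<m)
                                (λ (_ , m<r , q<m) → ℚ.<-trans q<m m<r)
  ; disjoint        = λ _ (r<q , q<r) → ℚ.<-asym r<q q<r
  ; located         = locate
  }
  where
  locate : ∀ {a b} → a ℚ.< b → a ℚ.< q ⊎ q ℚ.< b
  locate {a} a<b with a ℚ.<? q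
  ... | yes a<q = inj₁ a<q
  ... | no a≮q  = inj₂ (ℚ.≤-<-trans (ℚ.≮⇒≥ a≮q) a<b)

upper⇒<fromℚ : ∀ x {q} → q ∈ upper x → x <ᵣ fromℚ q
upper⇒<fromℚ x {q} q∈x with r , r<q , r∈x ← to (upper-rounded x q) q∈x = r , r∈x , r<q

lower⇒fromℚ< : ∀ x {q} → q ∈ lower x → fromℚ q <ᵣ x
lower⇒fromℚ< x {q} q∈x with r , q<r , r∈x ← to (lower-rounded x q) q∈x = r , q<r , r∈x

<ᵣ-dense : ∀ x y → x <ᵣ y → ∃[ m ] x <ᵣ m × m <ᵣ y
<ᵣ-dense x y (q , q∈x , q∈y) = fromℚ q , upper⇒<fromℚ x q∈x , lower⇒fromℚ< y q∈y

<ᵣ-unbounded : ∀ x → ∃[ y ] x <ᵣ y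
<ᵣ-unbounded x with q , q∈x ← upper-inhabited x = fromℚ q , upper⇒<fromℚ x q∈x

-- The bound is sought among rationals because these, unlike reals, can be compared.
upper-common : ∀ {n} (f : Fin n → ℝ) → ∃[ q ] ∀ i → q ∈ upper (f i)
upper-common {zero}  f = ℚ.0ℚ , λ ()
upper-common {suc n} f
  with a , a∈ ← upper-inhabited (f zero) | b , b∈ ← upper-common (f ∘ suc)
  with ℚ.≤-total a b
... | inj₁ a≤b = b , λ { zero → upper-closed (f zero) a∈ a≤b ; (suc i) → b∈ i }
... | inj₂ b≤a = a , λ { zero → a∈ ; (suc i) → upper-closed (f (suc i)) (b∈ i) b≤a }

bounded-above : ∀ {n} (f : Fin n → ℝ) → ∃[ b ] ∀ i → f i ≤ᵣ b
bounded-above f with q , q∈ ← upper-common f =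
  fromℚ q , λ i → <ᵣ⇒≤ᵣ (f i) (fromℚ q) (upper⇒<fromℚ (f i) (q∈ i))

-- Reflection of the line

neg : ℝ → ℝ
neg x = record
  { lower           = λ q → upper x (ℚ.- q)
  ; upper           = λ q → lower x (ℚ.- q)
  ; lower-inhabited = let q , q∈x = upper-inhabited x in
                      ℚ.- q , subst (upper x) (sym (neg-involutive q)) q∈x
  ; upper-inhabited = let q , q∈x = lower-inhabited x in
                      ℚ.- q , subst (lower x) (sym (neg-involutive q)) q∈x
  ; lower-rounded   = λ q → mk⇔
      (λ q∈ → let r , r< , r∈ = to (upper-rounded x (ℚ.- q)) q∈ in
        ℚ.- r , subst (ℚ._< ℚ.- r) (neg-involutive q) (ℚ.neg-antimono-< r<)
              , subst (upper x) (sym (neg-involutive r)) r∈)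
      (λ (r , q<r , r∈) → from (upper-rounded x (ℚ.- q)) (ℚ.- r , ℚ.neg-antimono-< q<r , r∈))
  ; upper-rounded   = λ q → mk⇔
      (λ q∈ → let r , r> , r∈ = to (lower-rounded x (ℚ.- q)) q∈ in
        ℚ.- r , subst (ℚ.- r ℚ.<_) (neg-involutive q) (ℚ.neg-antimono-< r>)
              , subst (lower x) (sym (neg-involutive r)) r∈)
      (λ (r , r<q , r∈) → from (lower-rounded x (ℚ.- q)) (ℚ.- r , ℚ.neg-antimono-< r<q , r∈))
  ; disjoint        = λ q (q∈u , q∈l) → disjoint x (ℚ.- q) (q∈l , q∈u)
  ; located         = λ q<r → swap (located x (ℚ.neg-antimono-< q<r))
  }

neg-anti-<ᵣ : ∀ x y → x <ᵣ y → neg y <ᵣ neg x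
neg-anti-<ᵣ x y (q , q∈x , q∈y) =
  ℚ.- q , subst (lower y) (sym (neg-involutive q)) q∈y
        , subst (upper x) (sym (neg-involutive q)) q∈x

neg-anti-≤ᵣ : ∀ x y → x ≤ᵣ y → neg y ≤ᵣ neg x
neg-anti-≤ᵣ x y x≤y (q , q∈x , q∈y) = x≤y (ℚ.- q , q∈y , q∈x)

neg-neg-≤ᵣ : ∀ x → neg (neg x) ≤ᵣ x
neg-neg-≤ᵣ x (q , q∈u , q∈l) =
  disjoint x q (subst (lower x) (neg-involutive q) q∈l , q∈u)

≤ᵣ-neg-neg : ∀ x → x ≤ᵣ neg (neg x)
≤ᵣ-neg-neg x (q , q∈u , q∈l) =
  disjoint x q (q∈l , subst (upper x) (neg-involutive q) q∈u)

-- `neg (neg x)` and `x` agree only in the sense of `_≤ᵣ_`; convexity over the degenerate segment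
-- from `x` to `x` carries membership across.
mirror : Interval → Interval
mirror I = record
  { points   = points I ∘ neg
  ; nonempty = let x , x∈I = nonempty I in
               neg x , convex I x x (neg (neg x)) x∈I x∈I (≤ᵣ-neg-neg x) (neg-neg-≤ᵣ x)
  ; convex   = λ x y t x∈ y∈ x≤t t≤y →
      convex I (neg y) (neg x) (neg t) y∈ x∈ (neg-anti-≤ᵣ t y t≤y) (neg-anti-≤ᵣ x t x≤t)
  }

neg∈mirror : ∀ I x → x ∈ points I → neg x ∈ points (mirror I)
neg∈mirror I x x∈I = convex I x x (neg (neg x)) x∈I x∈I (≤ᵣ-neg-neg x) (neg-neg-≤ᵣ x)

mirror-meets : ∀ I J → I meets J ⇔ mirror I meets mirror J
mirror-meets I J = mk⇔
  (λ (x , x∈I , x∈J) → neg x , neg∈mirror I x x∈I , neg∈mirror J x x∈J)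
  (λ (x , x∈I , x∈J) → neg x , x∈I , x∈J)

mirror-properlyContains : ∀ I J → mirror I properlyContains mirror J → I properlyContains J
mirror-properlyContains I J (J⊆I , I⊈J) = contained , λ I⊆J → I⊈J (λ {x} → I⊆J {neg x})
  where
  contained : points J ⊆ points I
  contained {x} x∈J =
    convex I (neg (neg x)) (neg (neg x)) x nnx∈I nnx∈I (neg-neg-≤ᵣ x) (≤ᵣ-neg-neg x)
    where nnx∈I = J⊆I {neg x} (neg∈mirror J x x∈J)

-- Cut-off intervals and increasing sequences of points

restrict : (I : Interval) (P : Pred ℝ 0ℓ) → (∀ x y → x ≤ᵣ y → y ∈ P → x ∈ P) →
           (∃[ x ] x ∈ points I × x ∈ P) → Interval
restrict I P down ne = record
  { points   = points I U.∩ P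
  ; nonempty = ne
  ; convex   = λ x y t (x∈I , _) (y∈I , y∈P) x≤t t≤y →
      convex I x y t x∈I y∈I x≤t t≤y , down t y t≤y y∈P
  }

hull : (x y : ℝ) → x ≤ᵣ y → Interval
hull x y x≤y = record
  { points   = λ t → x ≤ᵣ t × t ≤ᵣ y
  ; nonempty = x , ≤ᵣ-refl x , x≤y
  ; convex   = λ a b t (x≤a , _) (_ , b≤y) a≤t t≤b →
      ≤ᵣ-trans x a t x≤a a≤t , ≤ᵣ-trans t b y t≤b b≤y
  }

-- Turns natural numbers used as endpoints into points of the line, starting at `s` and staying
-- below `t`.
module Ladder (s t : ℝ) (s<t : s <ᵣ t) where

  ladder : ℕ → Σ[ x ∈ ℝ ] x <ᵣ t
  ladder zero    = s , s<t
  ladder (suc i) with m , _ , m<t ← <ᵣ-dense (proj₁ (ladder i)) t (proj₂ (ladder i)) = m , m<t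

  rung : ℕ → ℝ
  rung i = proj₁ (ladder i)

  rung≤t : ∀ i → rung i ≤ᵣ t
  rung≤t i = <ᵣ⇒≤ᵣ (rung i) t (proj₂ (ladder i))

  rung-step : ∀ i → rung i <ᵣ rung (suc i)
  rung-step i = proj₁ (proj₂ (<ᵣ-dense (rung i) t (proj₂ (ladder i))))

  rung-mono′ : ∀ {i j} → i ℕ.≤′ j → rung i ≤ᵣ rung j
  rung-mono′ {i} (ℕ.≤′-reflexive refl) = ≤ᵣ-refl (rung i)
  rung-mono′ {i} (ℕ.≤′-step {j} i≤j) =
    ≤ᵣ-trans (rung i) (rung j) (rung (suc j)) (rung-mono′ i≤j)
      (<ᵣ⇒≤ᵣ (rung j) (rung (suc j)) (rung-step j))

  rung-mono : ∀ {i j} → i ℕ.≤ j → rung i ≤ᵣ rung j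
  rung-mono i≤j = rung-mono′ (ℕ.≤⇒≤′ i≤j)

  rung-strict : ∀ {i j} → i ℕ.< j → ¬ (rung j ≤ᵣ rung i)
  rung-strict {i} {j} i<j j≤i =
    -- `_≤ᵣ_` is a negation, so the chain from `rung (suc i)` down to `rung i` is refuted by
    -- applying it to `rung-step i`.
    ≤ᵣ-trans (rung (suc i)) (rung j) (rung i) (rung-mono i<j) j≤i (rung-step i)

-- Finite sets and interval orders

¬¬-∀ : ∀ {ℓ n} {P : Pred (Fin n) ℓ} → (∀ i → ¬ ¬ P i) → ¬ ¬ (∀ i → P i)
¬¬-∀ = Fin.sequence (RawMonad.rawApplicative ¬¬-Monad)

collect : ∀ {n} {P : Pred (Fin n) 0ℓ} → U.Decidable P → Subset n
collect P? = Vec.tabulate (λ i → does (P? i))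

∈-collect⁺ : ∀ {n} {P : Pred (Fin n) 0ℓ} (P? : U.Decidable P) {i} → P i → i Sub.∈ collect P?
∈-collect⁺ P? {i} p =
  Vec.lookup⇒[]= i _ (trans (Vec.lookup∘tabulate _ i) (dec-true (P? i) p))

∈-collect⁻ : ∀ {n} {P : Pred (Fin n) 0ℓ} (P? : U.Decidable P) {i} → i Sub.∈ collect P? → P i
∈-collect⁻ P? {i} i∈
  with P? i | trans (sym (Vec.lookup∘tabulate (λ j → does (P? j)) i)) (Vec.[]=⇒lookup i∈)
... | yes p | _ = p
... | no _  | ()

-- Fishburn's axioms: by his theorem these are exactly the precedence orders of finite families of
-- intervals.
record IsIntervalOrder {n} (_≺_ : Rel (Fin n) 0ℓ) : Set where
  field
    _≺?_    : Decidable _≺_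
    irrefl  : ∀ {v} → ¬ (v ≺ v)
    2+2-free : ∀ {u v u′ v′} → u ≺ v → u′ ≺ v′ → u ≺ v′ ⊎ u′ ≺ v

  ≺-trans : ∀ {u v w} → u ≺ v → v ≺ w → u ≺ w
  ≺-trans u≺v v≺w = [ id , (λ v≺v → ⊥-elim (irrefl v≺v)) ] (2+2-free u≺v v≺w)

flip-isIntervalOrder : ∀ {n} {_≺_ : Rel (Fin n) 0ℓ} →
                       IsIntervalOrder _≺_ → IsIntervalOrder (flip _≺_)
flip-isIntervalOrder io = record
  { _≺?_     = λ v w → w ≺? v
  ; irrefl   = irrefl
  ; 2+2-free = λ v≺u v′≺u′ → swap (2+2-free v≺u v′≺u′)
  }
  where open IsIntervalOrder io

-- The canonical representation of an interval order: the left end of v is the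
-- number of predecessors of v, its right end the number of common predecessors
-- of all the successors of v.
module Canonical {n} {_≺_ : Rel (Fin n) 0ℓ} (io : IsIntervalOrder _≺_) where
  open IsIntervalOrder io

  below : ∀ v → U.Decidable (_≺ v)
  below v u = u ≺? v

  BelowSuccessors : Fin n → Pred (Fin n) 0ℓ
  BelowSuccessors v u = ∀ w → v ≺ w → u ≺ w

  belowSuccessors? : ∀ v → U.Decidable (BelowSuccessors v)
  belowSuccessors? v u = Fin.all? (λ w → (v ≺? w) →-dec (u ≺? w))

  left right : Fin n → ℕ
  left v  = Sub.∣ collect (below v) ∣
  right v = Sub.∣ collect (belowSuccessors? v) ∣

  ≺⇒right≤left : ∀ {v w} → v ≺ w → right v ℕ.≤ left w
  ≺⇒right≤left {v} {w} v≺w = Sub.p⊆q⇒∣p∣≤∣q∣ λ u∈ →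
    ∈-collect⁺ (below w) (∈-collect⁻ (belowSuccessors? v) u∈ w v≺w)

  -- By `2+2-free`, a predecessor of `w` precedes every successor of `v`, the alternative being
  -- `v ≺ w`. The inclusion is strict because `v` precedes its own successors but not `w`.
  ⊀⇒left<right : ∀ {v w} → ¬ (v ≺ w) → left w ℕ.< right v
  ⊀⇒left<right {v} {w} v⊀w = Sub.p⊂q⇒∣p∣<∣q∣
    ( (λ u∈ → ∈-collect⁺ (belowSuccessors? v) λ w′ v≺w′ →
        [ id , (λ v≺w → ⊥-elim (v⊀w v≺w)) ] (2+2-free (∈-collect⁻ (below w) u∈) v≺w′))
    , v , ∈-collect⁺ (belowSuccessors? v) (λ _ → id)
    , λ v∈ → v⊀w (∈-collect⁻ (below w) v∈))

-- The precedence order of a representation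

module Precedence {G : Graph} (α : Representation G) where
  open Graph G using (_~_; _~?_; ~-sym; ~-irrefl)

  anchor : Vertex G → ℝ
  anchor v = proj₁ (nonempty (interval α v))

  anchor∈ : ∀ v → anchor v ∈ points (interval α v)
  anchor∈ v = proj₂ (nonempty (interval α v))

  infix 4 _≺_

  -- Disjoint intervals are ordered like any sample points of theirs, so only finitely many
  -- comparisons of reals have to be decided.
  _≺_ : Rel (Vertex G) 0ℓ
  v ≺ w = v ≢ w × ¬ (v ~ w) × anchor v ≤ᵣ anchor w

  adjacent⇒⊀ : ∀ {v w} → v ~ w → ¬ (v ≺ w)
  adjacent⇒⊀ v~w (_ , v≁w , _) = v≁w v~w

  -- Suppose `y ≤ᵣ x`. If `anchor v ≤ᵣ y`, then `y` lies in `v` too; otherwise `anchor v` lies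
  -- between `y` and `anchor w`, hence in `w`. Either way the intervals meet.
  separated : ∀ {v w} → v ≺ w → ∀ x y → x ∈ points (interval α v) → y ∈ points (interval α w) →
              ¬ (y ≤ᵣ x)
  separated {v} {w} (v≢w , v≁w , v≤w) x y x∈v y∈w y≤x =
    byCases (anchor v ≤ᵣ y)
      (λ v≤y → v≁w (from (edges α v≢w)
        (y , convex (interval α v) (anchor v) x y (anchor∈ v) x∈v v≤y y≤x , y∈w)))
      (λ v≰y → v≁w (from (edges α v≢w)
        (anchor v , anchor∈ v ,
         convex (interval α w) y (anchor w) (anchor v) y∈w (anchor∈ w)
           (≰ᵣ⇒≥ᵣ (anchor v) y v≰y) v≤w)))

  -- Common points of `z` with `u` and with `w` enclose the interval of `v`, and the first of them
  -- is not in `v`.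
  between⇒contributes : ∀ {z u v w} → u ≺ v → v ≺ w → u ~ z → w ~ z → Contributes G z α v
  between⇒contributes {z} {u} {v} {w} u≺v v≺w u~z w~z
    with a , a∈u , a∈z ← to (edges α (λ { refl → ~-irrefl u~z })) u~z
       | b , b∈w , b∈z ← to (edges α (λ { refl → ~-irrefl w~z })) w~z =
    (λ {x} x∈v → convex (interval α z) a b x a∈z b∈z
      (≰ᵣ⇒≥ᵣ x a (separated u≺v a x a∈u x∈v))
      (≰ᵣ⇒≥ᵣ b x (separated v≺w x b x∈v b∈w)))
    , λ z⊆v → separated u≺v a a a∈u (z⊆v {a} a∈z) (≤ᵣ-refl a)

  module _ (anchor≤? : ∀ v w → Dec (anchor v ≤ᵣ anchor w)) where

    comparable : ∀ {v w} → v ≢ w → ¬ (v ~ w) → v ≺ w ⊎ w ≺ v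
    comparable {v} {w} v≢w v≁w with anchor≤? v w
    ... | yes v≤w = inj₁ (v≢w , v≁w , v≤w)
    ... | no v≰w  = inj₂ (≢-sym v≢w , v≁w ∘ ~-sym , ≰ᵣ⇒≥ᵣ (anchor v) (anchor w) v≰w)

    ⊀⇒overlap : ∀ v w → ¬ (v ≺ w) →
                ∃[ x ] ∃[ y ] x ∈ points (interval α v) × y ∈ points (interval α w) × y ≤ᵣ x
    ⊀⇒overlap v w v⊀w with v Fin.≟ w | v ~? w | anchor≤? v w
    ... | yes refl | _       | _      =
      anchor v , anchor v , anchor∈ v , anchor∈ v , ≤ᵣ-refl (anchor v)
    ... | no v≢w   | yes v~w | _      = let x , x∈v , x∈w = to (edges α v≢w) v~w in
                                        x , x , x∈v , x∈w , ≤ᵣ-refl x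
    ... | no v≢w   | no v≁w  | yes le = ⊥-elim (v⊀w (v≢w , v≁w , le))
    ... | no v≢w   | no v≁w  | no ¬le =
      anchor v , anchor w , anchor∈ v , anchor∈ w , ≰ᵣ⇒≥ᵣ (anchor v) (anchor w) ¬le

    isIntervalOrder : IsIntervalOrder _≺_
    isIntervalOrder = record
      { _≺?_     = _≺?_
      ; irrefl   = λ (v≢v , _) → v≢v refl
      ; 2+2-free = 2+2-free
      }
      where
      _≺?_ : Decidable _≺_
      v ≺? w = ¬? (v Fin.≟ w) ×-dec (¬? (v ~? w) ×-dec anchor≤? v w)

      2+2-free : ∀ {u v u′ v′} → u ≺ v → u′ ≺ v′ → u ≺ v′ ⊎ u′ ≺ v
      2+2-free {u} {v} {u′} {v′} u≺v u′≺v′ with u ≺? v′ | u′ ≺? v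
      ... | yes u≺v′ | _        = inj₁ u≺v′
      ... | no _     | yes u′≺v = inj₂ u′≺v
      -- The overlaps give `y ≤ x ≤ y′ ≤ x′` with `y` in `v′` and `x′` in `u′`, against `u′ ≺ v′`.
      ... | no u⊀v′  | no u′⊀v
        with x , y , x∈u , y∈v′ , y≤x ← ⊀⇒overlap u v′ u⊀v′
           | x′ , y′ , x′∈u′ , y′∈v , y′≤x′ ← ⊀⇒overlap u′ v u′⊀v =
        ⊥-elim (separated u′≺v′ x′ y x′∈u′ y∈v′
          (≤ᵣ-trans y x x′ y≤x (≤ᵣ-trans x y′ x′
            (≰ᵣ⇒≥ᵣ y′ x (separated u≺v x y′ x∈u y′∈v)) y′≤x′)))

-- Local components

module LocalComponent {G : Graph} {z : Vertex G} {H : Subset (size G)}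
                      (component : IsLocalComponent G z H) where
  open Graph G using (_~_; _~?_; ~-sym)

  private
    Link = LinkAvoiding G z
    root = proj₁ component

    reached : ∀ {w} → w Sub.∈ H ⇔ Star Link root w
    reached {w} = proj₂ (proj₂ component) w

    end≢z : ∀ {v w} → v ≢ z → Star Link v w → w ≢ z
    end≢z v≢z ε                     = v≢z
    end≢z v≢z ((_ , u≢z , _) ◅ uw) = end≢z u≢z uw

  ∈⇒≢z : ∀ {v} → v Sub.∈ H → v ≢ z
  ∈⇒≢z v∈H = end≢z (proj₁ (proj₂ component)) (to reached v∈H)

  z∉H : z Sub.∉ H
  z∉H z∈H = ∈⇒≢z z∈H refl

  closed : ∀ {v w} → v Sub.∈ H → w ≢ z → v ~ w → w Sub.∈ H
  closed v∈H w≢z v~w = from reached (to reached v∈H ◅◅ ((∈⇒≢z v∈H , w≢z , v~w) ◅ ε))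

  boundary : ∀ {v w} → v Sub.∈ H → w Sub.∉ H → v ~ w → w ≡ z
  boundary {v} {w} v∈H w∉H v~w with w Fin.≟ z
  ... | yes w≡z = w≡z
  ... | no w≢z  = ⊥-elim (w∉H (closed v∈H w≢z v~w))

  connected : ∀ {v w} → v Sub.∈ H → w Sub.∈ H → Star Link v w
  connected v∈H w∈H =
    reverse (λ (a , b , v~w) → b , a , ~-sym v~w) (to reached v∈H) ◅◅ to reached w∈H

  -- On a path in `H` from `a` to `b`, `e` is the first vertex not adjacent to `z`, and `c` is the
  -- one before it.
  leaving-edge : ∀ {a b} → a Sub.∈ H → b Sub.∈ H → a ~ z → ¬ (b ~ z) →
                 ∃[ c ] ∃[ e ] c Sub.∈ H × e Sub.∈ H × c ~ z × ¬ (e ~ z) × c ~ e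
  leaving-edge a∈H b∈H = go a∈H (connected a∈H b∈H)
    where
    go : ∀ {a b} → a Sub.∈ H → Star Link a b → a ~ z → ¬ (b ~ z) →
         ∃[ c ] ∃[ e ] c Sub.∈ H × e Sub.∈ H × c ~ z × ¬ (e ~ z) × c ~ e
    go a∈H ε a~z a≁z = ⊥-elim (a≁z a~z)
    go {a} a∈H (_◅_ {j = u} (_ , u≢z , a~u) ub) a~z b≁z with u ~? z
    ... | yes u~z = go (closed a∈H u≢z a~u) ub u~z b≁z
    ... | no u≁z  = a , u , a∈H , closed a∈H u≢z a~u , a~z , u≁z , a~u

  -- The order is abstract so that the flipped order of a representation can be used as well.
  module _ {_≺_ : Rel (Vertex G) 0ℓ} (io : IsIntervalOrder _≺_)
           (adjacent⇒⊀ : ∀ {v w} → v ~ w → ¬ (v ≺ w))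
           (comparable : ∀ {v w} → v ≢ w → ¬ (v ~ w) → v ≺ w ⊎ w ≺ v)
           {u} (u∉H : u Sub.∉ H) (u≢z : u ≢ z) where
    open IsIntervalOrder io

    u≁H : ∀ {h} → h Sub.∈ H → ¬ (u ~ h)
    u≁H h∈H u~h = u∉H (closed h∈H u≢z (~-sym u~h))

    u≢H : ∀ {h} → h Sub.∈ H → u ≢ h
    u≢H h∈H refl = u∉H h∈H

    -- Adjacent `h` and `j` cannot lie on different sides of `u`, as transitivity through `u` would
    -- make them comparable; this spreads along paths.
    sameSide : ∀ {h k} → h Sub.∈ H → k Sub.∈ H → u ≺ h → u ≺ k
    sameSide h∈H k∈H = go h∈H (connected h∈H k∈H)
      where
      go : ∀ {h k} → h Sub.∈ H → Star Link h k → u ≺ h → u ≺ k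
      go h∈H ε u≺h = u≺h
      go {h} h∈H (_◅_ {j = j} (_ , j≢z , h~j) jk) u≺h
        with j∈H ← closed h∈H j≢z h~j
        with comparable (u≢H j∈H) (u≁H j∈H)
      ... | inj₁ u≺j = go j∈H jk u≺j
      ... | inj₂ j≺u = ⊥-elim (adjacent⇒⊀ (~-sym h~j) (≺-trans j≺u u≺h))

-- Integer layouts of a local component

-- Integer endpoints for H ∪ {z}, with z itself placed at the point 0.
record Layout (G : Graph) (z : Vertex G) (H : Subset (size G)) : Set where
  open Graph G using (_~_)
  field
    left right : Vertex G → ℕ
    left≤right : ∀ {h} → h Sub.∈ H → left h ℕ.≤ right h
    0<right    : ∀ {h} → h Sub.∈ H → 0 ℕ.< right h
    left≡0     : ∀ {h} → h Sub.∈ H → h ~ z → left h ≡ 0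
    0<left     : ∀ {h} → h Sub.∈ H → ¬ (h ~ z) → 0 ℕ.< left h
    interleave : ∀ {h k} → h Sub.∈ H → k Sub.∈ H → h ~ k → left h ℕ.≤ right k
    apart      : ∀ {h k} → h Sub.∈ H → k Sub.∈ H → h ≢ k → ¬ (h ~ k) →
                 right h ℕ.< left k ⊎ right k ℕ.< left h

-- By the last hypothesis no vertex of `H` precedes a neighbour of `z`, so the left ends of these
-- neighbours can all be moved to 0 without new intersections inside `H`.
layout-from-order :
  ∀ {G z H} {_≺_ : Rel (Vertex G) 0ℓ} (let open Graph G using (_~_)) → IsIntervalOrder _≺_ →
  (∀ {v w} → v ~ w → ¬ (v ≺ w)) →
  (∀ {v w} → v ≢ w → ¬ (v ~ w) → v ≺ w ⊎ w ≺ v) →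
  (∀ {h k} → h Sub.∈ H → h ≺ k → ¬ (k ~ z)) →
  Layout G z H
layout-from-order {G} {z} {H} {_≺_} io adjacent⇒⊀ comparable ≺⇒≁z = record
  { left       = λ h → leftEnd h (h ~? z)
  ; right      = right
  ; left≤right = λ _ → ⊀⇒≤ irrefl
  ; 0<right    = λ _ → ℕ.≤-<-trans z≤n (⊀⇒left<right irrefl)
  ; left≡0     = λ _ → left≡0
  ; 0<left     = λ _ → 0<left
  ; interleave = λ _ _ h~k → ⊀⇒≤ (adjacent⇒⊀ (~-sym h~k))
  ; apart      = λ h∈H k∈H h≢k h≁k → Sum.map (≺⇒< h∈H) (≺⇒< k∈H) (comparable h≢k h≁k)
  }
  where
  open Graph G using (_~_; _~?_; ~-sym)
  open IsIntervalOrder io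
  open Canonical io

  -- The canonical intervals are half-open; adding one to the left end makes them closed and
  -- reserves 0 for the neighbours of `z`.
  leftEnd : ∀ h → Dec (h ~ z) → ℕ
  leftEnd h (yes _) = 0
  leftEnd h (no _)  = suc (left h)

  ⊀⇒≤ : ∀ {h k} → ¬ (k ≺ h) → leftEnd h (h ~? z) ℕ.≤ right k
  ⊀⇒≤ {h} k⊀h with h ~? z
  ... | yes _ = z≤n
  ... | no _  = ⊀⇒left<right k⊀h

  left≡0 : ∀ {h} → h ~ z → leftEnd h (h ~? z) ≡ 0
  left≡0 {h} h~z with h ~? z
  ... | yes _  = refl
  ... | no h≁z = ⊥-elim (h≁z h~z)

  0<left : ∀ {h} → ¬ (h ~ z) → 0 ℕ.< leftEnd h (h ~? z)
  0<left {h} h≁z with h ~? z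
  ... | yes h~z = ⊥-elim (h≁z h~z)
  ... | no _    = s≤s z≤n

  ≺⇒< : ∀ {h k} → h Sub.∈ H → h ≺ k → right h ℕ.< leftEnd k (k ~? z)
  ≺⇒< {h} {k} h∈H h≺k with k ~? z
  ... | yes k~z = ⊥-elim (≺⇒≁z h∈H h≺k k~z)
  ... | no _    = s≤s (≺⇒right≤left h≺k)

-- A contributor u lies outside H, so H lies on one side of u.  A vertex of H
-- between u and a neighbour of z would itself contribute, so among the
-- vertices of H the neighbours of z come first, seen from u.
layout-from-unconfined :
  ∀ {G z H} → IsLocalComponent G z H → (β : Representation G) →
  (∀ v → v Sub.∈ H → ¬ Contributes G z β v) → ∃ (Contributes G z β) →
  ¬ ¬ Layout G z H
layout-from-unconfined {G} {z} {H} component β unconfined (u , z⊃u@(u⊆z , z⊈u)) ¬layout =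
  ¬¬-∀ (λ v → ¬¬-∀ {P = λ w → Dec (anchor v ≤ᵣ anchor w)} (λ w → ¬¬-excluded-middle)) λ anchor≤? →
  let io  = isIntervalOrder anchor≤?
      io′ = flip-isIntervalOrder io
      cmp = comparable anchor≤?
      cmp′ : ∀ {v w} → v ≢ w → ¬ (v ~ w) → w ≺ v ⊎ v ≺ w
      cmp′ v≢w v≁w = swap (cmp v≢w v≁w)
      adj′ : ∀ {v w} → v ~ w → ¬ (w ≺ v)
      adj′ v~w = adjacent⇒⊀ (~-sym v~w)
  in [ (λ u≺r → ¬layout (layout-from-order io adjacent⇒⊀ cmp λ h∈H h≺k k~z →
         unconfined _ h∈H (between⇒contributes
           (sameSide io adjacent⇒⊀ cmp u∉H u≢z root∈H h∈H u≺r) h≺k u~z k~z)))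
     , (λ r≺u → ¬layout (layout-from-order io′ adj′ cmp′ λ h∈H k≺h k~z →
         unconfined _ h∈H (between⇒contributes
           k≺h (sameSide io′ adj′ cmp′ u∉H u≢z root∈H h∈H r≺u) k~z u~z)))
     ] (cmp (λ { refl → u∉H root∈H }) (u≁H io adjacent⇒⊀ cmp u∉H u≢z root∈H))
  where
  open Graph G using (_~_; ~-sym)
  open Precedence β
  open LocalComponent {G} {z} {H} component

  root∈H : proj₁ component Sub.∈ H
  root∈H = from (proj₂ (proj₂ component) _) ε

  u∉H : u Sub.∉ H
  u∉H u∈H = unconfined u u∈H z⊃u

  u≢z : u ≢ z
  u≢z refl = z⊈u id

  u~z : u ~ z
  u~z = from (edges β u≢z) (anchor u , anchor∈ u , u⊆z (anchor∈ u))

-- Completing a partial representation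

Represents : (G : Graph) → (Vertex G → Interval) → Pred (Vertex G) 0ℓ → Set₁
Represents G J D = ∀ {v w} → D v → D w → v ≢ w → Graph._~_ G v w ⇔ J v meets J w

-- J represents only part of G: the witness γ represents all of G, without
-- any vertex of H contributing and without new contributors outside H.
Completes : (G : Graph) → Vertex G → Subset (size G) → (Vertex G → Interval) → Set₁
Completes G z H J =
  Σ[ γ ∈ Representation G ] (∀ v → ContainedIn γ z v → v Sub.∉ H × J z properlyContains J v)

-- Blocks of neighbours of `z` start at `s`, all other blocks strictly later. Hence `free` tolerates
-- an outside interval at `s` itself, but not beyond, when `h` is no neighbour of `z`.
module Insertion
  {G : Graph} {z : Vertex G} {H : Subset (size G)} (component : IsLocalComponent G z H)
  (layout : Layout G z H)
  {K : Vertex G → Interval} (represents : Represents G K (Sub._∉ H))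
  (s t : ℝ) (s<t : s <ᵣ t)
  (z≤s : ∀ x → x ∈ points (K z) → x ≤ᵣ s)
  (s∈z : ∀ {h} → h Sub.∈ H → Graph._~_ G h z → s ∈ points (K z))
  (free : ∀ {h v} → h Sub.∈ H → v Sub.∉ H → v ≢ z → ∀ x → x ∈ points (K v) →
          s ≤ᵣ x → x ≤ᵣ t → ¬ (Graph._~_ G h z ⊎ ¬ (x ≤ᵣ s)))
  where
  open Graph G using (_~_; _~?_; ~-sym)
  open Layout layout
  open LocalComponent {G} {z} {H} component
  open Ladder s t s<t

  block : ∀ {h} → h Sub.∈ H → Interval
  block {h} h∈H = hull (rung (left h)) (rung (right h)) (rung-mono (left≤right h∈H))

  place : ∀ v → Dec (v Sub.∈ H) → Interval
  place v (yes v∈H) = block v∈H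
  place v (no _)    = K v

  blocks : ∀ {v w} (v∈H : v Sub.∈ H) (w∈H : w Sub.∈ H) → v ≢ w →
           v ~ w ⇔ block v∈H meets block w∈H
  blocks {v} {w} v∈H w∈H v≢w = mk⇔
    (λ v~w → rung (left v ℕ.⊔ left w)
      , (rung-mono (ℕ.m≤m⊔n (left v) (left w))
        , rung-mono (ℕ.⊔-lub (left≤right v∈H) (interleave w∈H v∈H (~-sym v~w))))
      , (rung-mono (ℕ.m≤n⊔m (left v) (left w))
        , rung-mono (ℕ.⊔-lub (interleave v∈H w∈H v~w) (left≤right w∈H))))
    meet
    where
    meet : block v∈H meets block w∈H → v ~ w
    meet (x , (lv≤x , x≤rv) , (lw≤x , x≤rw)) with v ~? w
    ... | yes v~w = v~w
    ... | no v≁w with apart v∈H w∈H v≢w v≁w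
    ...   | inj₁ rv<lw =
      ⊥-elim (rung-strict rv<lw (≤ᵣ-trans (rung (left w)) x (rung (right v)) lw≤x x≤rv))
    ...   | inj₂ rw<lv =
      ⊥-elim (rung-strict rw<lv (≤ᵣ-trans (rung (left v)) x (rung (right w)) lv≤x x≤rw))

  block-outside : ∀ {v w} (v∈H : v Sub.∈ H) → w Sub.∉ H → v ~ w ⇔ block v∈H meets K w
  block-outside {v} {w} v∈H w∉H = mk⇔ touch meet
    where
    touch : v ~ w → block v∈H meets K w
    touch v~w with refl ← boundary v∈H w∉H v~w =
      s , (subst (λ i → rung i ≤ᵣ s) (sym (left≡0 v∈H v~w)) (≤ᵣ-refl s)
           , rung-mono (z≤n {right v})) , s∈z v∈H v~w

    meet : block v∈H meets K w → v ~ w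
    meet (x , (l≤x , x≤r) , x∈w) with w Fin.≟ z | v ~? z
    ... | yes refl | yes v~z = v~z
    ... | yes refl | no v≁z  =
      ⊥-elim (rung-strict (0<left v∈H v≁z) (≤ᵣ-trans (rung (left v)) x s l≤x (z≤s x x∈w)))
    ... | no w≢z | dec = ⊥-elim (free v∈H w∉H w≢z x x∈w
        (≤ᵣ-trans s (rung (left v)) x (rung-mono (z≤n {left v})) l≤x)
        (≤ᵣ-trans x (rung (right v)) t x≤r (rung≤t (right v)))
        (position dec))
      where
      position : Dec (v ~ z) → v ~ z ⊎ ¬ (x ≤ᵣ s)
      position (yes v~z) = inj₁ v~z
      position (no v≁z)  = inj₂ λ x≤s →
        rung-strict (0<left v∈H v≁z) (≤ᵣ-trans (rung (left v)) x s l≤x x≤s)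

  place-edges : ∀ {v w} (v∈? : Dec (v Sub.∈ H)) (w∈? : Dec (w Sub.∈ H)) → v ≢ w →
                v ~ w ⇔ place v v∈? meets place w w∈?
  place-edges (yes v∈H) (yes w∈H) v≢w = blocks v∈H w∈H v≢w
  place-edges (yes v∈H) (no w∉H)  _   = block-outside v∈H w∉H
  place-edges (no v∉H)  (no w∉H)  v≢w = represents v∉H w∉H v≢w
  place-edges (no v∉H)  (yes w∈H) _   = mk⇔
    (λ v~w → let x , x∈w , x∈v = to (block-outside w∈H v∉H) (~-sym v~w) in x , x∈v , x∈w)
    (λ (x , x∈v , x∈w) → ~-sym (from (block-outside w∈H v∉H) (x , x∈w , x∈v)))

  contributors : ∀ {v} (z∈? : Dec (z Sub.∈ H)) (v∈? : Dec (v Sub.∈ H)) →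
                 place z z∈? properlyContains place v v∈? → v Sub.∉ H × K z properlyContains K v
  contributors (yes z∈H) _ _ = ⊥-elim (z∉H z∈H)
  contributors (no _) (no v∉H) z⊃v = v∉H , z⊃v
  -- The right end of a block is a positive rung, so it lies beyond `s`, where the interval of `z`
  -- has no points.
  contributors {v} (no _) (yes v∈H) (v⊆z , _) = ⊥-elim (rung-strict (0<right v∈H)
    (z≤s (rung (right v)) (v⊆z {rung (right v)}
      (rung-mono (left≤right v∈H) , ≤ᵣ-refl (rung (right v))))))

  completes : Completes G z H K
  completes = record
    { interval = λ v → place v (v Sub.∈? H)
    ; edges    = λ {v} {w} → place-edges (v Sub.∈? H) (w Sub.∈? H)
    } , λ v → contributors (z Sub.∈? H) (v Sub.∈? H)

mirror-represents : ∀ {G J D} → Represents G J D → Represents G (mirror ∘ J) D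
mirror-represents {J = J} J-represents {v} {w} v∈D w∈D v≢w = mk⇔
  (to (mirror-meets (J v) (J w)) ∘ to edge) (from edge ∘ from (mirror-meets (J v) (J w)))
  where edge = J-represents v∈D w∈D v≢w

completes-mono : ∀ {G z H J K} →
                 (∀ v → v Sub.∉ H → K z properlyContains K v → J z properlyContains J v) →
                 Completes G z H K → Completes G z H J
completes-mono f (γ , contributors) = γ , λ v z⊃v →
  let v∉H , Kz⊃Kv = contributors v z⊃v in v∉H , f v v∉H Kz⊃Kv

properlyContains-mono : ∀ I I′ J J′ → points I ⊆ points I′ → points J′ ⊆ points J →
                        I properlyContains J → I′ properlyContains J′
properlyContains-mono I I′ J J′ I⊆I′ J′⊆J (J⊆I , I⊈J) =
  (λ {x} x∈J′ → I⊆I′ {x} (J⊆I {x} (J′⊆J {x} x∈J′)))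
  , λ I′⊆J′ → I⊈J λ {x} x∈I → J′⊆J {x} (I′⊆J′ {x} (I⊆I′ {x} x∈I))

-- With s a common point of c and z, and t a common point of c and e, the part
-- of [s,t] beyond s is free for H once the interval of z is cut off at s.
completeRight :
  ∀ {G z H} (let open Graph G using (_~_)) → IsLocalComponent G z H → Layout G z H →
  ∀ {J x c e} → Represents G J (_≢ x) → x Sub.∈ H → c Sub.∈ H → e Sub.∈ H → c ≢ x → e ≢ x →
  ¬ (e ~ z) → ∀ s t → s ∈ points (J c) → s ∈ points (J z) → t ∈ points (J c) → t ∈ points (J e) →
  s <ᵣ t → Completes G z H J
completeRight {G} {z} {H} component layout {J} {x} {c} {e} represents x∈H c∈H e∈H c≢x e≢x e≁z
              s t s∈c s∈z t∈c t∈e s<t =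
  completes-mono {G} {z} {H} {J} {K} shrink
    (Insertion.completes component layout {K} K-represents s t s<t
      (λ _ (_ , below) → below refl) (λ _ _ → s∈z , λ _ → ≤ᵣ-refl s)
      λ {_} {v} _ v∉H v≢z y (y∈v , _) s≤y y≤t _ → c-disjoint v∉H v≢z y y∈v s≤y y≤t)
  where
  open Graph G using (_~_)
  open LocalComponent {G} {z} {H} component

  ∉H⇒≢x : ∀ {v} → v Sub.∉ H → v ≢ x
  ∉H⇒≢x v∉H refl = v∉H x∈H

  -- The segment from `s` to `t` lies in the interval of `c`, whose only neighbour outside `H` can
  -- be `z`.
  c-disjoint : ∀ {v} → v Sub.∉ H → v ≢ z → ∀ y → y ∈ points (J v) → s ≤ᵣ y → ¬ (y ≤ᵣ t)
  c-disjoint {v} v∉H v≢z y y∈v s≤y y≤t = v≢z (boundary c∈H v∉H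
    (from (represents c≢x (∉H⇒≢x v∉H) λ { refl → v∉H c∈H })
      (y , convex (J c) s t y s∈c t∈c s≤y y≤t , y∈v)))

  z≤t : ∀ y → y ∈ points (J z) → y ≤ᵣ t
  z≤t y y∈z t<y = e≁z (from (represents e≢x (∉H⇒≢x z∉H) (∈⇒≢z e∈H))
    (t , t∈e , convex (J z) s y t s∈z y∈z (<ᵣ⇒≤ᵣ s t s<t) (<ᵣ⇒≤ᵣ t y t<y)))

  -- Conditional on `v ≡ z`, so that one `restrict` serves all vertices and changes only the
  -- interval of `z`.
  Kept : Vertex G → Pred ℝ 0ℓ
  Kept v y = v ≡ z → y ≤ᵣ s

  inhabited : ∀ v → ∃[ y ] y ∈ points (J v) × Kept v y
  inhabited v with v Fin.≟ z
  ... | yes refl = s , s∈z , λ _ → ≤ᵣ-refl s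
  ... | no v≢z   = let y , y∈v = nonempty (J v) in y , y∈v , ⊥-elim ∘ v≢z

  K : Vertex G → Interval
  K v = restrict (J v) (Kept v)
    (λ y y′ y≤y′ kept v≡z → ≤ᵣ-trans y y′ s y≤y′ (kept v≡z)) (inhabited v)

  -- The part of `z` beyond `s` ends by `t`, within the interval of `c`; cutting it off therefore
  -- loses no adjacency.
  z-meets-below : ∀ {v} → v Sub.∉ H → v ≢ z → ∀ y → y ∈ points (J z) → y ∈ points (J v) → y ≤ᵣ s
  z-meets-below v∉H v≢z y y∈z y∈v s<y = c-disjoint v∉H v≢z y y∈v (<ᵣ⇒≤ᵣ s y s<y) (z≤t y y∈z)

  K-represents : Represents G K (Sub._∉ H)
  K-represents {v} {w} v∉H w∉H v≢w = mk⇔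
    (λ v~w → let y , y∈v , y∈w = to edge v~w in y
      , (y∈v , λ { refl → z-meets-below w∉H (≢-sym v≢w) y y∈v y∈w })
      , (y∈w , λ { refl → z-meets-below v∉H v≢w y y∈w y∈v }))
    (λ (y , (y∈v , _) , (y∈w , _)) → from edge (y , y∈v , y∈w))
    where edge = represents (∉H⇒≢x v∉H) (∉H⇒≢x w∉H) v≢w

  shrink : ∀ v → v Sub.∉ H → K z properlyContains K v → J z properlyContains J v
  shrink v _ Kz⊃Kv = properlyContains-mono (K z) (J z) (K v) (J v) proj₁
    (λ y∈v → y∈v , λ { refl → ⊥-elim (proj₂ Kz⊃Kv id) }) Kz⊃Kv

-- If `t` lies to the left of `s`, the mirror image is completed instead. That suffices, since
-- `Completes` refers to `J` only through proper containments, which reflect back.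
complete-adjacent :
  ∀ {G z H} (let open Graph G using (_~_)) → IsLocalComponent G z H → Layout G z H →
  ∀ {J x c e} → Represents G J (_≢ x) → x Sub.∈ H → c Sub.∈ H → e Sub.∈ H → c ≢ x → e ≢ x →
  c ~ z → c ~ e → ¬ (e ~ z) → ¬ ¬ Completes G z H J
complete-adjacent {G} {z} {H} component layout {J} {x} {c} {e} represents x∈H c∈H e∈H c≢x e≢x
                  c~z c~e e≁z ¬completes =
  let s , s∈c , s∈z = to (represents c≢x z≢x (∈⇒≢z c∈H)) c~z
      t , t∈c , t∈e = to (represents c≢x e≢x (λ { refl → Graph.~-irrefl G c~e })) c~e
  in
  byCases (s <ᵣ t)
    (λ s<t → ¬completes (right {J} represents s t s∈c s∈z t∈c t∈e s<t))
    λ t≤s → byCases (t <ᵣ s)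
      (λ t<s → ¬completes (completes-mono {G} {z} {H} {J} {mirror ∘ J}
        (λ v _ → mirror-properlyContains (J z) (J v))
        (right {mirror ∘ J} (mirror-represents {G} {J} {_≢ x} represents) (neg s) (neg t)
          (neg∈mirror (J c) s s∈c) (neg∈mirror (J z) s s∈z)
          (neg∈mirror (J c) t t∈c) (neg∈mirror (J e) t t∈e) (neg-anti-<ᵣ t s t<s))))
      -- Now `s` and `t` coincide in the order, so `t` lies in the interval of `z` and `e` would be
      -- adjacent to `z`.
      λ s≤t → e≁z (from (represents e≢x z≢x (∈⇒≢z e∈H))
        (t , t∈e , convex (J z) s s t s∈z s∈z s≤t t≤s))
  where
  open LocalComponent {G} {z} {H} component

  z≢x : z ≢ x
  z≢x = ≢-sym (∈⇒≢z x∈H)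

  right = λ {J′} (r : Represents G J′ (_≢ x)) →
    completeRight {G} {z} {H} component layout {J′} {x} {c} {e} r x∈H c∈H e∈H c≢x e≢x e≁z

-- With `s = T`, every block starts strictly beyond `T`, since no vertex of `H` is adjacent to `z`.
complete-detached :
  ∀ {G z H} (let open Graph G using (_~_)) → IsLocalComponent G z H → Layout G z H →
  ∀ {J x} → Represents G J (_≢ x) → x Sub.∈ H → (∀ {h} → h Sub.∈ H → ¬ (h ~ z)) →
  (∃[ T ] ∀ v y → y ∈ points (J v) → y ≤ᵣ T) → Completes G z H J
complete-detached {H = H} component layout {J} {x} represents x∈H detached (T , ≤T)
  with t , T<t ← <ᵣ-unbounded T =
  Insertion.completes component layout {J}
    (λ v∉H w∉H → represents (λ { refl → v∉H x∈H }) (λ { refl → w∉H x∈H })) T t T<t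
    (≤T _) (λ h∈H h~z → ⊥-elim (detached h∈H h~z))
    λ {_} {v} h∈H _ _ y y∈v _ _ → [ detached h∈H , (λ y≰T → y≰T (≤T v y y∈v)) ]

-- Representations bounded on the right

-- All intervals are cut off beyond all intersections, that of z a bit earlier
-- than the others.  An interval that is changed by this still leaves that of z.
truncate : ∀ {G} (α : Representation G) z →
           Σ[ γ ∈ Representation G ] (∀ v → ContainedIn γ z v → ContainedIn α z v) ×
             ∃[ T ] ∀ v y → y ∈ points (interval γ v) → y ≤ᵣ T
truncate {G} α z =
  record { interval = K ; edges = K-edges } , shrink , T , λ _ _ (_ , _ , y≤T) → y≤T
  where
  open Graph G using (_~_; _~?_; ~-irrefl)

  J : Vertex G → Interval
  J = interval α

  select : ∀ v w → Dec (v ~ w) → ℝ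
  select v w (yes v~w) = proj₁ (to (edges α (λ { refl → ~-irrefl v~w })) v~w)
  -- This default also covers `common v v`, which gives each interval a point that survives the cut.
  select v w (no _)    = proj₁ (nonempty (J v))

  common : Vertex G → Vertex G → ℝ
  common v w = select v w (v ~? w)

  common∈ˡ : ∀ v w → common v w ∈ points (J v)
  common∈ˡ v w with v ~? w
  ... | yes v~w = proj₁ (proj₂ (to (edges α (λ { refl → ~-irrefl v~w })) v~w))
  ... | no _    = proj₂ (nonempty (J v))

  common∈ʳ : ∀ {v w} → v ~ w → common v w ∈ points (J w)
  common∈ʳ {v} {w} v~w with v ~? w
  ... | yes p  = proj₂ (proj₂ (to (edges α (λ { refl → ~-irrefl p })) p))
  ... | no v≁w = ⊥-elim (v≁w v~w)

  rowBound : ∀ v → ∃[ b ] ∀ w → common v w ≤ᵣ b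
  rowBound v = bounded-above (common v)

  b T : ℝ
  b = proj₁ (bounded-above (proj₁ ∘ rowBound))
  T = proj₁ (<ᵣ-unbounded b)

  b<T : b <ᵣ T
  b<T = proj₂ (<ᵣ-unbounded b)

  common≤b : ∀ v w → common v w ≤ᵣ b
  common≤b v w = ≤ᵣ-trans (common v w) (proj₁ (rowBound v)) b
    (proj₂ (rowBound v) w) (proj₂ (bounded-above (proj₁ ∘ rowBound)) v)

  Kept : Vertex G → Pred ℝ 0ℓ
  Kept v y = (v ≡ z → y ≤ᵣ b) × y ≤ᵣ T

  ≤b⇒kept : ∀ v y → y ≤ᵣ b → y ∈ Kept v
  ≤b⇒kept v y y≤b = (λ _ → y≤b) , ≤ᵣ-trans y b T y≤b (<ᵣ⇒≤ᵣ b T b<T)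

  K : Vertex G → Interval
  K v = restrict (J v) (Kept v)
    (λ x y x≤y (y≤b , y≤T) → (λ v≡z → ≤ᵣ-trans x y b x≤y (y≤b v≡z)) , ≤ᵣ-trans x y T x≤y y≤T)
    (common v v , common∈ˡ v v , ≤b⇒kept v (common v v) (common≤b v v))

  K-edges : ∀ {v w} → v ≢ w → v ~ w ⇔ K v meets K w
  K-edges {v} {w} v≢w = mk⇔
    (λ v~w → common v w , (common∈ˡ v w , ≤b⇒kept v (common v w) (common≤b v w))
                        , (common∈ʳ v~w , ≤b⇒kept w (common v w) (common≤b v w)))
    (λ (y , (y∈v , _) , (y∈w , _)) → from (edges α v≢w) (y , y∈v , y∈w))

  shrink : ∀ v → K z properlyContains K v → J z properlyContains J v
  shrink v Kz⊃Kv@(Kv⊆Kz , Kz⊈Kv) = properlyContains-mono (K z) (J z) (K v) (J v) proj₁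
    (λ {y} y∈v → y∈v , ≤b⇒kept v y (v≤b y y∈v)) Kz⊃Kv
    where
    v≢z : v ≢ z
    v≢z refl = Kz⊈Kv id

    kept≤b : ∀ y → y ∈ points (J v) → y ≤ᵣ T → y ≤ᵣ b
    kept≤b y y∈v y≤T = proj₁ (proj₂ (Kv⊆Kz {y} (y∈v , ⊥-elim ∘ v≢z , y≤T))) refl

    v≤b : ∀ y → y ∈ points (J v) → y ≤ᵣ b
    v≤b y y∈v b<y = byCases (y ≤ᵣ T)
      (λ y≤T → kept≤b y y∈v y≤T b<y)
      -- A point of `v` beyond `T` brings `T` itself into `v` by convexity, and `T` already exceeds
      -- `b`.
      (λ y≰T → kept≤b T (convex (J v) (common v v) y T (common∈ˡ v v) y∈v
        (≤ᵣ-trans (common v v) b T (common≤b v v) (<ᵣ⇒≤ᵣ b T b<T)) (≰ᵣ⇒≥ᵣ y T y≰T))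
        (≤ᵣ-refl T) b<T)

-- Vertex deletion and the count of contributors

delete : ∀ {n} {x z : Fin n} → z ≢ x →
         Σ[ m ∈ ℕ ] m ℕ.< n × Σ[ f ∈ (Fin m ↣ Fin n) ] Σ[ g ∈ (Fin n → Fin m) ]
           (∀ {v} → v ≢ x → Injection.to f (g v) ≡ v)
delete {suc n} {x} {z} z≢x =
  n , ℕ.n<1+n n , mk↣ (λ {i} {j} → Fin.punchIn-injective x i j) , retract , punchIn-retract
  where
  retract : Fin (suc n) → Fin n
  retract v with v Fin.≟ x
  -- A default value: `x` is sent where `z` goes.
  ... | yes _  = Fin.punchOut (≢-sym z≢x)
  ... | no v≢x = Fin.punchOut (≢-sym v≢x)

  punchIn-retract : ∀ {v} → v ≢ x → Fin.punchIn x (retract v) ≡ v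
  punchIn-retract {v} v≢x with v Fin.≟ x
  ... | yes v≡x = ⊥-elim (v≢x v≡x)
  ... | no v≢x  = Fin.punchIn-punchOut (≢-sym v≢x)

AtLeast-≤ : ∀ {a} {A : Set} (P : Pred A a) {j k} → j ℕ.≤ k → AtLeast k P → AtLeast j P
AtLeast-≤ P j≤k (f , f∈P) =
  mk↣ (λ {i} {i′} eq → Fin.inject≤-injective j≤k j≤k i i′ (Injection.injective f eq))
  , λ i → f∈P (Fin.inject≤ i j≤k)

-- Injectivity is asked for on `P` only, because the retraction after a deletion identifies `x` with
-- `z`.
AtLeast-map : ∀ {a b} {A B : Set} (P : Pred A a) (Q : Pred B b) {k} (g : A → B) →
              (∀ {x y} → P x → P y → g x ≡ g y → x ≡ y) → (∀ {x} → P x → Q (g x)) →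
              AtLeast k P → AtLeast k Q
AtLeast-map P Q g g-inj P⇒Q (f , f∈P) =
  mk↣ (λ {i} {j} eq → Injection.injective f (g-inj (f∈P i) (f∈P j) eq)) , P⇒Q ∘ f∈P

theorem5 : (p : ℕ) (G : Graph) (z : Vertex G) →
    MinimalForbidden p G → IsBasepoint G z →
    (H : Subset (size G)) →
    IsPotentialSideComponent G z H → IsUnconfined G z H → IsExterior G z H →
    ∃[ e ] ∃[ c ] e ≢ c × H ≡ ⁅ e ⁆ ∪ ⁅ c ⁆ ×
    IsExteriorVertex G z e × Graph._~_ G c e × Graph._~_ G c z
theorem5 p G z forbidden (k , (improperₖ , _) , basepoint) H (_ , component , _) (β , unconfined)
         (o , o∈H , exterior) = conclude (Fin.any? (λ v → (v Sub.∈? H) ×-dec (v ~? z)))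
  where
  open Graph G using (_~_; _~?_; ~-sym; ~-irrefl)
  open MinimalForbidden forbidden
  open LocalComponent {G} {z} {H} component

  -- If `k ≤ p`, a representation attaining `k` would make `G` `p`-improper.
  p<k : suc p ℕ.≤ k
  p<k with suc p ℕ.≤? k
  ... | yes p<k = p<k
  ... | no p≮k  = ⊥-elim (notImproper (proj₁ improperₖ ,
    λ v → proj₂ improperₖ v ∘ AtLeast-≤ (ContainedIn (proj₁ improperₖ) v) (ℕ.≰⇒> p≮k)))

  crowded : ∀ α → AtLeast (suc p) (ContainedIn α z)
  crowded α = AtLeast-≤ (ContainedIn α z) p<k (basepoint α)

  contributor : ∃ (Contributes G z β)
  contributor = let f , f∈ = crowded β in Injection.to f zero , f∈ zero

  layout : ¬ ¬ Layout G z H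
  layout = layout-from-unconfined component β unconfined contributor

  module Deletion {x} (x∈H : x Sub.∈ H) where

    z≢x : z ≢ x
    z≢x = ≢-sym (∈⇒≢z x∈H)

    deletion = delete z≢x
    f = proj₁ (proj₂ (proj₂ deletion))
    g = proj₁ (proj₂ (proj₂ (proj₂ deletion)))

    f∘g : ∀ {v} → v ≢ x → Injection.to f (g v) ≡ v
    f∘g = proj₂ (proj₂ (proj₂ (proj₂ deletion)))

    g-injective : ∀ {v w} → v ≢ x → w ≢ x → g v ≡ g w → v ≡ w
    g-injective v≢x w≢x eq = trans (sym (f∘g v≢x)) (trans (cong (Injection.to f) eq) (f∘g w≢x))

    improper : Improper p (induced G f)
    improper = minimal f (proj₁ (proj₂ deletion))

    represents : (α : Representation (induced G f)) → Represents G (interval α ∘ g) (_≢ x)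
    represents α {v} {w} v≢x w≢x v≢w =
      subst (_⇔ (interval α (g v) meets interval α (g w)))
        (trans (cong (_~ Injection.to f (g w)) (f∘g v≢x)) (cong (v ~_) (f∘g w≢x)))
        (edges α (v≢w ∘ g-injective v≢x w≢x))

    -- In `γ` the basepoint has `p + 1` contributors. They avoid `H`, hence `x`, so `g` maps them
    -- injectively to contributors in `α`.
    incomplete : (α : Representation (induced G f)) → ¬ AtLeast (suc p) (ContainedIn α (g z)) →
                 ¬ Completes G z H (interval α ∘ g)
    incomplete α few (γ , contributors) = few (AtLeast-map (ContainedIn γ z) (ContainedIn α (g z)) g
      (λ {v} {w} z⊃v z⊃w → g-injective (≢x v z⊃v) (≢x w z⊃w))
      (λ {v} z⊃v → proj₂ (contributors v z⊃v)) (crowded γ))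
      where
      ≢x : ∀ v → ContainedIn γ z v → v ≢ x
      ≢x v z⊃v refl = proj₁ (contributors v z⊃v) x∈H

  -- A detached `H` needs room beyond all other intervals; truncating the representation left after
  -- deleting `o` provides it without new contributors at `g z`.
  ¬detached : ¬ (∀ {h} → h Sub.∈ H → ¬ (h ~ z))
  ¬detached detached = layout λ lay →
    incomplete (proj₁ truncated) (proj₂ improper (g z) ∘
        AtLeast-map (ContainedIn (proj₁ truncated) (g z)) (ContainedIn (proj₁ improper) (g z))
          id (λ _ _ → id) (λ {v} → proj₁ (proj₂ truncated) v))
      (complete-detached component lay {interval (proj₁ truncated) ∘ g}
        (represents (proj₁ truncated)) o∈H detached
        (proj₁ (proj₂ (proj₂ truncated)) , λ v → proj₂ (proj₂ (proj₂ truncated)) (g v)))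
    where
    open Deletion o∈H
    truncated = truncate (proj₁ improper) (g z)

  ¬third : ∀ {x c e} → x Sub.∈ H → c Sub.∈ H → e Sub.∈ H → c ≢ x → e ≢ x →
           c ~ z → c ~ e → ¬ ¬ (e ~ z)
  ¬third {x} {c} {e} x∈H c∈H e∈H c≢x e≢x c~z c~e e≁z = layout λ lay →
    complete-adjacent component lay {interval α ∘ g} {x} {c} {e} (represents α)
      x∈H c∈H e∈H c≢x e≢x c~z c~e e≁z (incomplete α (proj₂ improper (g z)))
    where
    open Deletion x∈H
    α = proj₁ improper

  o≁z : ¬ (o ~ z)
  o≁z o~z = ℕ.1+n≰n (exterior (~-sym o~z ∷ []))

  conclude : Dec (∃[ a ] a Sub.∈ H × a ~ z) → ∃[ e ] ∃[ c ] e ≢ c × H ≡ ⁅ e ⁆ ∪ ⁅ c ⁆ ×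
             IsExteriorVertex G z e × c ~ e × c ~ z
  conclude (no ¬attached) = ⊥-elim (¬detached λ h∈H h~z → ¬attached (_ , h∈H , h~z))
  conclude (yes (a , a∈H , a~z))
    -- The exterior vertex `e` found here may differ from `o`; what counts is that it is adjacent to
    -- a neighbour `c` of `z`.
    with c , e , c∈H , e∈H , c~z , e≁z , c~e ← leaving-edge a∈H o∈H a~z o≁z =
    e , c , (λ { refl → ~-irrefl c~e }) , Sub.⊆-antisym H⊆ec ec⊆H , distant , c~e , c~z
    where
    H⊆ec : H Sub.⊆ ⁅ e ⁆ ∪ ⁅ c ⁆
    H⊆ec {x} x∈H with x Fin.≟ e | x Fin.≟ c
    ... | yes refl | _        = Sub.x∈p∪q⁺ (inj₁ (Sub.x∈⁅x⁆ e))
    ... | no _     | yes refl = Sub.x∈p∪q⁺ (inj₂ (Sub.x∈⁅x⁆ c))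
    ... | no x≢e   | no x≢c   =
      ⊥-elim (¬third x∈H c∈H e∈H (≢-sym x≢c) (≢-sym x≢e) c~z c~e e≁z)

    ec⊆H : ⁅ e ⁆ ∪ ⁅ c ⁆ Sub.⊆ H
    ec⊆H x∈ with Sub.x∈p∪q⁻ ⁅ e ⁆ ⁅ c ⁆ x∈
    ... | inj₁ x∈e = subst (Sub._∈ H) (sym (Sub.x∈⁅y⁆⇒x≡y e x∈e)) e∈H
    ... | inj₂ x∈c = subst (Sub._∈ H) (sym (Sub.x∈⁅y⁆⇒x≡y c x∈c)) c∈H

    distant : IsExteriorVertex G z e
    distant []              = ⊥-elim (z∉H e∈H)
    distant (z~e ∷ [])      = ⊥-elim (e≁z (~-sym z~e))
    distant (_ ∷ (_ ∷ _))   = s≤s (s≤s z≤n)
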